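{- $\mathrm{FO}[\leq, \mathrm{fin}]$ cannot count beyond a constant; that is, for every nondecreasing unbounded function $f\colon \mathbb{N} \to \mathbb{N}$ with $f(n) \leq n$ for all $n$, the logic $\mathrm{FO}[\leq, \mathrm{fin}]$ cannot count up to $f(n)$.
   Context: Notation: $\mathbb{N} = \{0,1,2,\ldots\}$ and $[n] = \{0,1,\ldots,n-1\}$. A function $f\colon\mathbb{N}\to\mathbb{N}$ is nondecreasing if $m > n$ implies $f(m) \geq f(n)$. Logic on words: for a finite alphabet $A$, let $\sigma_A = \{\mathbf{a} \mid a \in A\}$ be a vocabulary of unary letter predicates. A word $u = u_0u_1\cdots u_{n-1} \in A^*$ is identified with the structure with universe $[n]$ in which $\mathbf{a}$ is interpreted as the set of positions $i$ with $u_i = a$. A numerical predicate is a $k$-ary relation symbol together with, for each universe size $n$, an interpretation which is a subset of $[n]^k$. It is unvaried if there is a set $E \subseteq \mathbb{N}^k$ such that its interpretation on universes of size $n$ is $E \cap [n]^k$ for every $n$; it is then identified with $E$. An unvaried predicate $P \subseteq \mathbb{N}^k$ is of finite degree if every $n \in \mathbb{N}$ appears in only finitely many tuples of $P$; $\mathrm{fin}$ is the class of all finite-degree predicates (of all arities). For a formula $\phi$ using numerical predicates, $u \models \phi$ means that $\phi$ is true in the structure of $u$ augmented with the interpretations of the numerical predicates for universe size $|u|$; free variables are assigned positions in $[|u|]$. $\mathrm{FO}[\leq,\mathrm{fin}]$ is the set of first-order formulas built using the order $\leq$, the predicates in $\mathrm{fin}$, and the letter predicates, for any alphabet $A$. For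 a nondecreasing function $f$ with $f(n) \leq n$, a logic counts up to $f(n)$ if there is a formula $\phi(c)$ in this logic such that for all $n$ and all $w \in \{0,1\}^n$ (and all values of $c$ in the universe $[n]$): \[w \models \phi(c) \Leftrightarrow c \leq f(n) \text{ and } c = \text{the number of 1's in } w.\] -}

module Defs where

open import Data.Fin using (Fin; zero; suc; toℕ)
import Data.Fin.Properties as Fin
open import Data.List using (List)
import Data.List.Membership.Propositional as List
open import Data.Nat using (ℕ; suc; _≤_; _<_; _>_; _≥_)
open import Data.Product using (∃; _×_; _,_)
open import Data.Sum using (_⊎_)
open import Data.Vec using (Vec; []; _∷_; lookup; map; count)
import Data.Vec.Membership.Propositional as Vec
open import Function.Bundles using (_⇔_)
open import Level using (0ℓ)
open import Relation.Binary.PropositionalEquality using (_≡_)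
open import Relation.Nullary using (¬_)
open import Relation.Unary using (Pred)

Nondecreasing : (ℕ → ℕ) → Set
Nondecreasing f = ∀ m n → m > n → f m ≥ f n

Unbounded : (ℕ → ℕ) → Set
Unbounded f = ∀ b → ∃ λ n → b < f n

NumericalPredicate : ℕ → Set₁
NumericalPredicate k = ∀ n → Pred (Vec (Fin n) k) 0ℓ

_IsUnvariedBy_ : ∀ {k} → NumericalPredicate k → Pred (Vec ℕ k) 0ℓ → Set
P IsUnvariedBy E = ∀ n t → P n t ⇔ E (map toℕ t)

-- Finiteness is given by a list covering the tuples of E that contain n; the
-- list may also contain other tuples, so E need not be decidable.
FiniteDegree : ∀ {k} → Pred (Vec ℕ k) 0ℓ → Set
FiniteDegree {k} E =
  ∀ n → ∃ λ (ts : List (Vec ℕ k)) → ∀ t → E t → n Vec.∈ t → t List.∈ ts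

PredicateClass : Set₂
PredicateClass = ∀ {k} → NumericalPredicate k → Set₁

fin : PredicateClass
fin P = ∃ λ E → P IsUnvariedBy E × FiniteDegree E

infix  8 _`≡_ _`≤_
infix  7 `¬_
infixr 6 _`∧_
infixr 5 _`∨_
infixr 4 _`⇒_

-- FO[≤, 𝒩 ] A m: formulas over the alphabet A whose free variables are among
-- m de Bruijn indices; a quantifier binds index zero.
data FO[≤,_] (𝒩 : PredicateClass) (A : Set) (m : ℕ) : Set₁ where
  _`≡_   : Fin m → Fin m → FO[≤, 𝒩 ] A m
  _`≤_   : Fin m → Fin m → FO[≤, 𝒩 ] A m
  letter : A → Fin m → FO[≤, 𝒩 ] A m
  num    : ∀ {k} (P : NumericalPredicate k) → 𝒩 P → Vec (Fin m) k → FO[≤, 𝒩 ] A m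
  `¬_    : FO[≤, 𝒩 ] A m → FO[≤, 𝒩 ] A m
  _`∧_   : FO[≤, 𝒩 ] A m → FO[≤, 𝒩 ] A m → FO[≤, 𝒩 ] A m
  _`∨_   : FO[≤, 𝒩 ] A m → FO[≤, 𝒩 ] A m → FO[≤, 𝒩 ] A m
  _`⇒_   : FO[≤, 𝒩 ] A m → FO[≤, 𝒩 ] A m → FO[≤, 𝒩 ] A m
  `∃_    : FO[≤, 𝒩 ] A (suc m) → FO[≤, 𝒩 ] A m
  `∀_    : FO[≤, 𝒩 ] A (suc m) → FO[≤, 𝒩 ] A m

infix 3 _,_⊨_

_,_⊨_ : ∀ {𝒩 : PredicateClass} {A m n} → Vec A n → Vec (Fin n) m → FO[≤, 𝒩 ] A m → Set
w , ρ ⊨ x `≡ y     = lookup ρ x ≡ lookup ρ y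
w , ρ ⊨ x `≤ y     = toℕ (lookup ρ x) ≤ toℕ (lookup ρ y)
w , ρ ⊨ letter a x = lookup w (lookup ρ x) ≡ a
_,_⊨_ {n = n} w ρ (num P _ xs) = P n (map (lookup ρ) xs)
w , ρ ⊨ `¬ φ       = ¬ (w , ρ ⊨ φ)
w , ρ ⊨ φ `∧ ψ     = (w , ρ ⊨ φ) × (w , ρ ⊨ ψ)
w , ρ ⊨ φ `∨ ψ     = (w , ρ ⊨ φ) ⊎ (w , ρ ⊨ ψ)
w , ρ ⊨ φ `⇒ ψ     = (w , ρ ⊨ φ) → (w , ρ ⊨ ψ)
w , ρ ⊨ `∃ φ       = ∃ λ i → w , i ∷ ρ ⊨ φ
w , ρ ⊨ `∀ φ       = ∀ i → w , i ∷ ρ ⊨ φ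

ones : ∀ {n} → Vec (Fin 2) n → ℕ
ones = count (Fin._≟ suc zero)

FO[≤,_]CountsUpTo_ : PredicateClass → (ℕ → ℕ) → Set₁
FO[≤, 𝒩 ]CountsUpTo f =
  ∃ λ (φ : FO[≤, 𝒩 ] (Fin 2) 1) →
    ∀ n (w : Vec (Fin 2) n) (c : Fin n) →
      (w , c ∷ [] ⊨ φ) ⇔ (toℕ c ≤ f n × toℕ c ≡ ones w)

-- A tuple of a finite-degree predicate that meets [0, lo) is contained in
-- [0, gap lo) for some function gap. Hence, if no position under consideration
-- lies in [lo, gap lo), the predicates never relate low positions to high ones,
-- and quantifiers are dealt with by cutting a longer gap in two, at its midpoint.
-- A Feferman–Vaught argument then shows that, when the low part of the word is
-- fixed, φ sees only one of T types of the high part, where T depends on φ alone.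
-- For hi and n large, of the words 0^hi 1^i 0^* with i ≤ T and length n, two have
-- the same type, say for i < j. The free position c = i is low, so φ(i) cannot
-- tell the word with i ones from the word with j ones.
module Submission where

open import Defs
open import Data.Fin using (Fin; zero; suc; toℕ; fromℕ<; finToFun; funToFin; splitAt; join)
open import Data.Fin.Properties
  using (finToFun-funToFin; pigeonhole; sequence; splitAt-join; toℕ-fromℕ<; toℕ<n)
open import Data.List using (List; concatMap; upTo)
import Data.List.Relation.Unary.All as List
open import Data.List.Extrema.Nat using (max; xs≤max; ⊥≤max)
open import Data.List.Membership.Propositional using (lose)
open import Data.List.Membership.Propositional.Properties using (∈-concatMap⁺; ∈-upTo⁺)
open import Data.Maybe using (Maybe; just; nothing)
open import Data.Maybe.Properties using (just-injective)
open import Data.Nat using (ℕ; zero; suc; _+_; _^_; _⊔_; _≤_; _<_; z≤n; s≤s; s≤s⁻¹; _<?_)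
open import Data.Nat.Properties
open import Data.Product using (∃; _×_; _,_; proj₁; proj₂)
open import Data.Sum using (_⊎_; inj₁; inj₂; [_,_]′; swap)
open import Data.Vec using (Vec; []; _∷_; _++_; head; tail; lookup; map; replicate; toList)
open import Data.Vec.Membership.Propositional using (_∈_; find)
open import Data.Vec.Membership.Propositional.Properties using (∈-map⁺; ∈-toList⁺)
open import Data.Vec.Properties using (lookup-++-<; lookup-replicate; map-∘)
open import Data.Vec.Relation.Unary.All as All using (All; []; _∷_)
open import Effect.Monad using (RawMonad)
open import Function using (_∘_; case_of_; id)
open import Function.Bundles using (_⇔_; mk⇔; Equivalence)
open import Level using (0ℓ)
open import Relation.Binary.PropositionalEquality
  using (_≡_; refl; sym; trans; cong; cong₂; subst; subst₂)
open import Relation.Nullary using (¬_; Dec; yes; no; contradiction; ¬¬-excluded-middle)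
open import Relation.Nullary.Negation using (¬¬-Monad)
open import Relation.Unary using (Pred)

open Equivalence using (to; from)
open RawMonad (¬¬-Monad {0ℓ}) using (pure; _>>=_; _<$>_; rawApplicative)

private variable
  A B C   : Set
  k m n   : ℕ
  w w′    : Vec A n
  ρ ρ′    : Vec (Fin n) m

-- Refuting `B → C` refutes `C`, by constant functions; `f` then refutes `B`, and `B → C` holds
-- vacuously.
¬¬-→ : (B → ¬ ¬ C) → ¬ ¬ (B → C)
¬¬-→ f ¬g = ¬g λ b → contradiction (λ c → ¬g λ _ → c) (f b)

map-cong-All : {f g : B → C} {xs : Vec B k} →
  All (λ x → f x ≡ g x) xs → map f xs ≡ map g xs
map-cong-All []         = refl
map-cong-All (eq ∷ eqs) = cong₂ _∷_ eq (map-cong-All eqs)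

map-just-injective : {xs ys : Vec B k} → map just xs ≡ map just ys → xs ≡ ys
map-just-injective {xs = []}    {[]}    _  = refl
map-just-injective {xs = _ ∷ _} {_ ∷ _} eq =
  cong₂ _∷_ (just-injective (cong head eq)) (map-just-injective (cong tail eq))

-- Reach of finite-degree predicates, and types of the high part.

neighbours : {E : Pred (Vec ℕ k) 0ℓ} → FiniteDegree E → ℕ → List ℕ
neighbours fd lo = concatMap (concatMap toList ∘ proj₁ ∘ fd) (upTo lo)

span : {E : Pred (Vec ℕ k) 0ℓ} → FiniteDegree E → ℕ → ℕ
span fd lo = max lo (neighbours fd lo)

-- For `x < lo`, the list given by `fd x` covers every tuple of `E` through `x`, so all entries of
-- such a tuple occur in `neighbours fd lo`.
span-bounds : {E : Pred (Vec ℕ k) 0ℓ} (fd : FiniteDegree E) {lo : ℕ} {t : Vec ℕ k} {x y : ℕ} →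
  E t → x ∈ t → x < lo → y ∈ t → y ≤ span fd lo
span-bounds fd {lo} {t} {x} Et x∈t x<lo y∈t = List.lookup (xs≤max lo _)
  (∈-concatMap⁺ _ (lose (∈-upTo⁺ x<lo)
    (∈-concatMap⁺ toList (lose (proj₂ (fd x) t Et x∈t) (∈-toList⁺ y∈t)))))

-- Properties of the high part of a word. In an assignment Vec (Maybe (Fin n)) m,
-- low variables are nothing. The properties presuppose that no variable has its
-- value in [lo, gap lo).
record Invariants (A : Set) (m : ℕ) : Set₁ where
  field
    gap    : ℕ → ℕ
    lo≤gap : ∀ lo → lo ≤ gap lo
    size   : ℕ
    Holds  : ℕ → Fin size → ∀ {n} → Vec A n → Vec (Maybe (Fin n)) m → Set

  -- A type is a set of properties coded as a number, so that types can index further properties in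
  -- `quantified` and serve as pigeonholes.
  HasType : ℕ → Fin (2 ^ size) → ∀ {n} → Vec A n → Vec (Maybe (Fin n)) m → Set
  HasType lo T w σ = ∀ i → Holds lo i w σ ⇔ finToFun T i ≡ suc zero

  -- Excluded middle for finitely many properties holds under double negation, which suffices
  -- because the theorem is a negation.
  ¬¬-type : ∀ lo {n} (w : Vec A n) σ → ¬ ¬ ∃ λ T → HasType lo T w σ
  ¬¬-type lo w σ = type <$> sequence rawApplicative (λ i → ¬¬-excluded-middle)
    where
    bit : Dec B → Fin 2
    bit (yes _) = suc zero
    bit (no  _) = zero

    bit-reflects : (B? : Dec B) → B ⇔ bit B? ≡ suc zero
    bit-reflects (yes b) = mk⇔ (λ _ → refl) (λ _ → b)
    bit-reflects (no ¬b) = mk⇔ (λ b → contradiction b ¬b) λ ()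

    type : (∀ i → Dec (Holds lo i w σ)) → ∃ λ T → HasType lo T w σ
    type dec = funToFin (bit ∘ dec) , λ i →
      subst (λ b → Holds lo i w σ ⇔ b ≡ suc zero)
        (sym (finToFun-funToFin (bit ∘ dec) i)) (bit-reflects (dec i))

-- If some variable of `xs` is low, no `t` exists and the property is false: it speaks only of
-- tuples that are entirely high.
atom : (gap : ℕ → ℕ) → (∀ lo → lo ≤ gap lo) →
  (∀ {n} → Vec A n → Vec (Fin n) k → Set) → Vec (Fin m) k → Invariants A m
atom gap lo≤gap P xs = record
  { gap    = gap
  ; lo≤gap = lo≤gap
  ; size   = 1
  ; Holds  = λ _ _ w σ → ∃ λ t → map just t ≡ map (lookup σ) xs × P w t
  }

both : Invariants A m → Invariants A m → Invariants A m
both I J = record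
  { gap    = λ lo → I.gap lo ⊔ J.gap lo
  ; lo≤gap = λ lo → ≤-trans (I.lo≤gap lo) (m≤m⊔n _ _)
  ; size   = I.size + J.size
  ; Holds  = λ lo i w σ →
      [ (λ i → I.Holds lo i w σ) , (λ i → J.Holds lo i w σ) ]′ (splitAt I.size i)
  }
  where
  module I = Invariants I
  module J = Invariants J

-- A bound position below the cut acts as one more low variable. Above the cut, all that matters is
-- which types such positions realise: one property per type.
quantified : Invariants A (suc m) → Invariants A m
quantified I = record
  { gap    = gap ∘ gap
  ; lo≤gap = λ lo → ≤-trans (lo≤gap lo) (lo≤gap (gap lo))
  ; size   = size + 2 ^ size
  ; Holds  = λ lo i w σ →
      [ (λ i → Holds (gap lo) i w (nothing ∷ σ))
      , (λ T → ∃ λ p → gap lo ≤ toℕ p × HasType lo T w (just p ∷ σ))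
      ]′ (splitAt size i)
  }
  where open Invariants I

invariants : FO[≤, fin ] A m → Invariants A m
invariants (x `≡ y)     = atom id (λ _ → ≤-refl) (λ { _ (p ∷ q ∷ []) → p ≡ q }) (x ∷ y ∷ [])
invariants (x `≤ y)     = atom id (λ _ → ≤-refl) (λ { _ (p ∷ q ∷ []) → toℕ p ≤ toℕ q }) (x ∷ y ∷ [])
invariants (letter a x) = atom id (λ _ → ≤-refl) (λ { w (p ∷ []) → lookup w p ≡ a }) (x ∷ [])
-- `span-bounds` is a weak inequality; `suc` puts the far end of the gap strictly beyond every
-- related position.
invariants (num P (_ , _ , fd) xs) =
  atom (suc ∘ span fd) (λ lo → m≤n⇒m≤1+n (⊥≤max lo (neighbours fd lo))) (λ _ → P _) xs
invariants (`¬ φ)       = invariants φ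
invariants (φ `∧ ψ)     = both (invariants φ) (invariants ψ)
invariants (φ `∨ ψ)     = both (invariants φ) (invariants ψ)
invariants (φ `⇒ ψ)     = both (invariants φ) (invariants ψ)
invariants (`∃ φ)       = quantified (invariants φ)
invariants (`∀ φ)       = quantified (invariants φ)

-- Similar assignments and the back-and-forth step.

Low : ℕ → (p q : Fin n) (r s : Maybe (Fin n)) → Set
Low lo p q r s = p ≡ q × toℕ p < lo × r ≡ nothing × s ≡ nothing

High : ℕ → (p q : Fin n) (r s : Maybe (Fin n)) → Set
High hi p q r s = hi ≤ toℕ p × hi ≤ toℕ q × r ≡ just p × s ≡ just q

-- A position in an Ehrenfeucht-Fraïssé game on `w` and `w′`: low variables have the same value on
-- both sides, high ones are tied only through `alike`. As the game goes on, `lo` may grow and `hi`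
-- may shrink.
record Similar (I : Invariants A m) {n} (w w′ : Vec A n) (ρ ρ′ : Vec (Fin n) m) : Set where
  open Invariants I
  field
    lo hi   : ℕ
    gap≤hi  : gap lo ≤ hi
    agree   : ∀ p → toℕ p < hi → lookup w p ≡ lookup w′ p
    σ σ′    : Vec (Maybe (Fin n)) m
    matched : ∀ x → Low  lo (lookup ρ x) (lookup ρ′ x) (lookup σ x) (lookup σ′ x)
                  ⊎ High hi (lookup ρ x) (lookup ρ′ x) (lookup σ x) (lookup σ′ x)
    alike   : ∀ i → Holds lo i w σ ⇔ Holds lo i w′ σ′

  lo≤hi : lo ≤ hi
  lo≤hi = ≤-trans (lo≤gap lo) gap≤hi

⇔-sym : B ⇔ C → C ⇔ B
⇔-sym e = mk⇔ (from e) (to e)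

Similar-sym : {I : Invariants A m} → Similar I w w′ ρ ρ′ → Similar I w′ w ρ′ ρ
Similar-sym S = record
  { lo      = lo
  ; hi      = hi
  ; gap≤hi  = gap≤hi
  ; agree   = λ p p<hi → sym (agree p p<hi)
  ; σ       = σ′
  ; σ′      = σ
  ; matched = λ x → case matched x of λ where
      (inj₁ (p≡q , p<lo , r , s)) → inj₁ (sym p≡q , subst (λ p → toℕ p < lo) p≡q p<lo , s , r)
      (inj₂ (p , q , r , s))      → inj₂ (q , p , s , r)
  ; alike   = λ i → ⇔-sym (alike i)
  }
  where open Similar S

⇔-splitAt : ∀ a {b} {F F′ : Fin a → Set} {G G′ : Fin b → Set} →
  (∀ i → [ F , G ]′ (splitAt a i) ⇔ [ F′ , G′ ]′ (splitAt a i)) →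
  (∀ i → F i ⇔ F′ i) × (∀ j → G j ⇔ G′ j)
⇔-splitAt a {b} {F} {F′} {G} {G′} e = at ∘ inj₁ , at ∘ inj₂
  where
  at : ∀ s → [ F , G ]′ s ⇔ [ F′ , G′ ]′ s
  at s = subst (λ s → [ F , G ]′ s ⇔ [ F′ , G′ ]′ s) (splitAt-join a b s) (e (join a b s))

Similar-both : (I J : Invariants A m) → Similar (both I J) w w′ ρ ρ′ →
  Similar I w w′ ρ ρ′ × Similar J w w′ ρ ρ′
Similar-both I J S =
    record { Similar S using (lo; hi; agree; σ; σ′; matched)
           ; gap≤hi = m⊔n≤o⇒m≤o (gap I lo) _ gap≤hi
           ; alike  = proj₁ (⇔-splitAt (size I) alike) }
  , record { Similar S using (lo; hi; agree; σ; σ′; matched)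
           ; gap≤hi = m⊔n≤o⇒n≤o (gap I lo) _ gap≤hi
           ; alike  = proj₂ (⇔-splitAt (size I) alike) }
  where
  open Similar S
  open Invariants using (gap; size)

-- The gap [lo, gap (gap lo)) is cut at mid = gap lo: a position below mid is low
-- for the gap [mid, gap mid), and one above mid is high for the gap [lo, mid).
forth : (I : Invariants A (suc m)) → Similar (quantified I) w w′ ρ ρ′ →
  ∀ p → ¬ ¬ ∃ λ q → Similar I w w′ (p ∷ ρ) (q ∷ ρ′)
forth {w = w} {w′} {ρ} {ρ′} I S p with toℕ p <? Invariants.gap I (Similar.lo S)
... | yes p<mid = pure (p , record
  { Similar S using (hi; gap≤hi; agree)
  ; lo      = gap lo
  ; σ       = nothing ∷ σ
  ; σ′      = nothing ∷ σ′
  ; matched = λ where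
      zero    → inj₁ (refl , p<mid , refl , refl)
      (suc x) → case matched x of λ where
        (inj₁ (p≡q , p<lo , r , s)) → inj₁ (p≡q , <-≤-trans p<lo (lo≤gap lo) , r , s)
        (inj₂ h)                    → inj₂ h
  ; alike   = proj₁ (⇔-splitAt size alike)
  })
  where
  open Similar S
  open Invariants I
... | no p≮mid = do
  -- In `w`, `p` witnesses that its type is realised above the cut; by `alike`, some `q` realises it
  -- in `w′`.
  T , p∶T ← ¬¬-type lo w (just p ∷ σ)
  let q , mid≤q , q∶T = to (proj₂ (⇔-splitAt size alike) T) (p , ≮⇒≥ p≮mid , p∶T)
  pure (q , record
    { Similar S using (lo)
    ; hi      = gap lo
    ; gap≤hi  = ≤-refl
    ; agree   = λ p p<mid → agree p (<-≤-trans p<mid mid≤hi)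
    ; σ       = just p ∷ σ
    ; σ′      = just q ∷ σ′
    ; matched = λ where
        zero    → inj₂ (≮⇒≥ p≮mid , mid≤q , refl , refl)
        (suc x) → case matched x of λ where
          (inj₁ l)               → inj₁ l
          (inj₂ (p , q , r , s)) → inj₂ (≤-trans mid≤hi p , ≤-trans mid≤hi q , r , s)
    ; alike   = λ i → mk⇔ (from (q∶T i) ∘ to (p∶T i)) (from (p∶T i) ∘ to (q∶T i))
    })
  where
  open Similar S
  open Invariants I
  mid≤hi : gap lo ≤ hi
  mid≤hi = ≤-trans (lo≤gap (gap lo)) gap≤hi

-- Transfer of truth between similar assignments.

module _ {I : Invariants A m} {w w′ : Vec A n} (S : Similar I w w′ ρ ρ′) where
  open Similar S

  LowAt HighAt : Fin m → Set
  LowAt  x = Low  lo (lookup ρ x) (lookup ρ′ x) (lookup σ x) (lookup σ′ x)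
  HighAt x = High hi (lookup ρ x) (lookup ρ′ x) (lookup σ x) (lookup σ′ x)

-- On entirely high tuples the one property of `atom` is the atom itself; `map just` is injective,
-- so the tuple that `alike` supplies is the one wanted.
transfer-atom : ∀ {gap : ℕ → ℕ} {lo≤gap} {P : ∀ {n} → Vec A n → Vec (Fin n) k → Set}
  {xs : Vec (Fin m) k} (S : Similar (atom gap lo≤gap P xs) w w′ ρ ρ′) →
  All (HighAt S) xs → P w (map (lookup ρ) xs) → P w′ (map (lookup ρ′) xs)
transfer-atom {w′ = w′} {ρ = ρ} {ρ′ = ρ′} {P = P} {xs} S high Pt =
  let t′ , t′≡ , Pt′ = to (alike zero) (_ , just-map (lookup ρ) (proj₁ ∘ proj₂ ∘ proj₂) , Pt)
  in subst (P w′)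
       (map-just-injective (trans t′≡ (sym (just-map (lookup ρ′) (proj₂ ∘ proj₂ ∘ proj₂))))) Pt′
  where
  open Similar S
  just-map : ∀ τ {τ̂} → (∀ {x} → HighAt S x → τ̂ x ≡ just (τ x)) → map just (map τ xs) ≡ map τ̂ xs
  just-map τ h = trans (sym (map-∘ just τ xs)) (map-cong-All (All.map (sym ∘ h) high))

transfer-num : (P : NumericalPredicate k) (d : fin P) (xs : Vec (Fin m) k) →
  Similar {A = A} (invariants (num P d xs)) w w′ ρ ρ′ →
  P n (map (lookup ρ) xs) → P n (map (lookup ρ′) xs)
transfer-num {ρ = ρ} P (E , unvaried , fd) xs S Pt
  with All.decide matched xs where open Similar S
... | inj₁ low = subst (P _) (map-cong-All (All.map proj₁ low)) Pt
... | inj₂ someHigh with All.decide (swap ∘ matched) xs where open Similar S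
...   | inj₁ high = transfer-atom S high Pt
-- Mixed case: an entry below `lo` bounds all entries by `span fd lo`, which is less than `gap lo`
-- and hence than every high value.
...   | inj₂ someLow =
  let x , x∈xs , _ , x<lo , _ = find someLow
      y , y∈xs , hi≤y , _     = find someHigh
      member : ∀ {z} → z ∈ xs → toℕ (lookup ρ z) ∈ map toℕ (map (lookup ρ) xs)
      member = ∈-map⁺ toℕ ∘ ∈-map⁺ (lookup ρ)
  in contradiction (span-bounds fd (to (unvaried _ _) Pt) (member x∈xs) x<lo (member y∈xs))
       (<⇒≱ (≤-trans gap≤hi hi≤y))
  where open Similar S

-- By induction on `φ`. One direction is enough because similarity is symmetric; the double negation
-- comes from `forth`, where types are found only up to double negation.
transfer : (φ : FO[≤, fin ] A m) → Similar (invariants φ) w w′ ρ ρ′ →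
  w , ρ ⊨ φ → ¬ ¬ (w′ , ρ′ ⊨ φ)
transfer (x `≡ y) S e with Similar.matched S x | Similar.matched S y
... | inj₁ (p , _)     | inj₁ (q , _)     = pure (trans (sym p) (trans e q))
... | inj₁ (_ , p , _) | inj₂ (q , _)     =
  contradiction (cong toℕ e) (<⇒≢ (<-≤-trans p (≤-trans (Similar.lo≤hi S) q)))
... | inj₂ (p , _)     | inj₁ (_ , q , _) =
  contradiction (cong toℕ (sym e)) (<⇒≢ (<-≤-trans q (≤-trans (Similar.lo≤hi S) p)))
... | inj₂ p           | inj₂ q           = pure (transfer-atom S (p ∷ q ∷ []) e)
transfer (x `≤ y) S e with Similar.matched S x | Similar.matched S y
... | inj₁ (p , _)        | inj₁ (q , _)        = pure (subst₂ (λ p q → toℕ p ≤ toℕ q) p q e)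
... | inj₁ (p , p<lo , _) | inj₂ (_ , hi≤q , _) = pure (subst (λ p → toℕ p ≤ _) p
  (≤-trans (<⇒≤ p<lo) (≤-trans (Similar.lo≤hi S) hi≤q)))
... | inj₂ (p , _)        | inj₁ (_ , q , _)    =
  contradiction e (<⇒≱ (<-≤-trans q (≤-trans (Similar.lo≤hi S) p)))
... | inj₂ p              | inj₂ q              = pure (transfer-atom S (p ∷ q ∷ []) e)
transfer {w′ = w′} (letter a x) S e with Similar.matched S x
... | inj₁ (p , p<lo , _) = pure (subst (λ p → lookup w′ p ≡ a) p
  (trans (sym (agree _ (<-≤-trans p<lo lo≤hi))) e)) where open Similar S
... | inj₂ p              = pure (transfer-atom S (p ∷ []) e)
transfer (num P d xs) S e = pure (transfer-num P d xs S e)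
transfer (`¬ φ) S ¬e = pure λ e → transfer φ (Similar-sym S) e ¬e
transfer (φ `∧ ψ) S (e , e′) = do
  let Sφ , Sψ = Similar-both (invariants φ) (invariants ψ) S
  f  ← transfer φ Sφ e
  f′ ← transfer ψ Sψ e′
  pure (f , f′)
transfer (φ `∨ ψ) S (inj₁ e) =
  inj₁ <$> transfer φ (proj₁ (Similar-both (invariants φ) (invariants ψ) S)) e
transfer (φ `∨ ψ) S (inj₂ e) =
  inj₂ <$> transfer ψ (proj₂ (Similar-both (invariants φ) (invariants ψ) S)) e
transfer (φ `⇒ ψ) S e = ¬¬-→ λ f → do
  let Sφ , Sψ = Similar-both (invariants φ) (invariants ψ) S
  g ← transfer φ (Similar-sym Sφ) f
  transfer ψ Sψ (e g)
transfer (`∃ φ) S (p , e) = do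
  q , S′ ← forth (invariants φ) S p
  f ← transfer φ S′ e
  pure (q , f)
-- Each `q` on the right is answered by a `p` on the left, so `forth` runs on the reversed
-- similarity. The universe is finite, so `sequence` pulls the double negation out of the
-- quantifier.
transfer (`∀ φ) S e = sequence rawApplicative λ q → do
  p , S′ ← forth (invariants φ) (Similar-sym S) q
  transfer φ (Similar-sym S′) (e p)

-- Words with a given number of ones, and the collision.

prefix : ∀ n → ℕ → Vec (Fin 2) n
prefix zero    _       = []
prefix (suc n) zero    = zero ∷ prefix n zero
prefix (suc n) (suc i) = suc zero ∷ prefix n i

ones-prefix : ∀ {n i} → i ≤ n → ones (prefix n i) ≡ i
ones-prefix {zero}  z≤n       = refl
ones-prefix {suc n} z≤n       = ones-prefix {n} z≤n
ones-prefix         (s≤s i≤n) = cong suc (ones-prefix i≤n)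

ones-padded : ∀ h (v : Vec (Fin 2) n) → ones (replicate h zero ++ v) ≡ ones v
ones-padded zero    v = refl
ones-padded (suc h) v = ones-padded h v

corollary1 : (f : ℕ → ℕ) → Nondecreasing f → Unbounded f → (∀ n → f n ≤ n) →
    ¬ (FO[≤, fin ]CountsUpTo f)
corollary1 f f-mono f-unbounded _ (φ , counts) =
  sequence rawApplicative (λ i → ¬¬-type lo (word (toℕ i)) (nothing ∷ [])) collide
  where
  open Invariants (invariants φ)
  types lo hi n₀ M : ℕ
  types = 2 ^ size
  -- One more word than there are types; each number of ones is below `lo`, hence a low position.
  lo    = suc types
  hi    = gap lo
  n₀    = proj₁ (f-unbounded types)
  -- `types` leaves room for the ones; `suc n₀` makes the length exceed `n₀`, so that monotonicity
  -- gives `types≤f`.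
  M     = suc (n₀ + types)

  word : ℕ → Vec (Fin 2) (hi + M)
  word i = replicate hi zero ++ prefix M i

  ones-word : ∀ {i} → i ≤ types → ones (word i) ≡ i
  ones-word {i} i≤ = trans (ones-padded hi (prefix M i))
    (ones-prefix (≤-trans i≤ (m≤n⇒m≤1+n (m≤n+m types n₀))))

  types≤f : types ≤ f (hi + M)
  types≤f = ≤-trans (<⇒≤ (proj₂ (f-unbounded types)))
    (f-mono _ _ (≤-trans (s≤s (m≤m+n n₀ types)) (m≤n+m M hi)))

  lookup-word : ∀ i p → toℕ p < hi → lookup (word i) p ≡ zero
  lookup-word i p p<hi =
    trans (lookup-++-< (replicate hi zero) (prefix M i) p p<hi) (lookup-replicate (fromℕ< p<hi) zero)

  similar : ∀ i j {T} (c : Fin (hi + M)) → toℕ c < lo →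
    HasType lo T (word i) (nothing ∷ []) → HasType lo T (word j) (nothing ∷ []) →
    Similar (invariants φ) (word i) (word j) (c ∷ []) (c ∷ [])
  similar i j c c<lo i∶T j∶T = record
    { lo      = lo
    ; hi      = hi
    ; gap≤hi  = ≤-refl
    ; agree   = λ p p<hi → trans (lookup-word i p p<hi) (sym (lookup-word j p p<hi))
    ; σ       = nothing ∷ []
    ; σ′      = nothing ∷ []
    ; matched = λ { zero → inj₁ (refl , c<lo , refl , refl) }
    ; alike   = λ k → mk⇔ (from (j∶T k) ∘ to (i∶T k)) (from (i∶T k) ∘ to (j∶T k))
    }

  collide : ¬ ((i : Fin lo) → ∃ λ T → HasType lo T (word (toℕ i)) (nothing ∷ []))
  collide typed with pigeonhole ≤-refl (proj₁ ∘ typed)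
  ... | i , j , i<j , Tᵢ≡Tⱼ = transfer φ S (from (counts _ _ c) (c≤f , c≡ones))
        λ e → <⇒≢ i<j (trans (sym c≡i) (trans (proj₂ (to (counts _ _ c) e)) (ones-word (bounded j))))
    where
    bounded : (k : Fin lo) → toℕ k ≤ types
    bounded k = s≤s⁻¹ (toℕ<n k)

    i<n : toℕ i < hi + M
    i<n = <-≤-trans (toℕ<n i) (≤-trans (lo≤gap lo) (m≤m+n hi M))

    c : Fin (hi + M)
    c = fromℕ< i<n

    c≡i : toℕ c ≡ toℕ i
    c≡i = toℕ-fromℕ< i<n

    c≤f : toℕ c ≤ f (hi + M)
    c≤f = subst (_≤ f (hi + M)) (sym c≡i) (≤-trans (bounded i) types≤f)

    c≡ones : toℕ c ≡ ones (word (toℕ i))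
    c≡ones = trans c≡i (sym (ones-word (bounded i)))

    S : Similar (invariants φ) (word (toℕ i)) (word (toℕ j)) (c ∷ []) (c ∷ [])
    S = similar (toℕ i) (toℕ j) c (subst (_< lo) (sym c≡i) (toℕ<n i)) (proj₂ (typed i))
      (subst (λ T → HasType lo T (word (toℕ j)) (nothing ∷ [])) (sym Tᵢ≡Tⱼ) (proj₂ (typed j)))
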